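{- Let $d,n$ be positive integers, let $K$ be a field of characteristic zero, and let $I\in\mathcal{A}_d(n)$ be an Artinian monomial ideal in $K[x_1,\dots,x_d]$. Then $I$ is strongly stable if and only if $\varphi(I)$ is a strongly stable partition.
   Context: Let $\mathbb{N}=\{0,1,2,\dots\}$ and, for $\alpha=(a_1,\dots,a_d)\in\mathbb{N}^d$, write $\mathbf{x}^\alpha=x_1^{a_1}\cdots x_d^{a_d}$. For a monomial ideal $I$, $G(I)$ denotes its unique minimal set of monomial generators. A pure power of $x_j$ is a monomial $x_j^k$. A monomial ideal is Artinian if the quotient ring has Krull dimension zero, equivalently it contains a pure power of each $x_j$. $\mathcal{A}_d(n)$ is the set of Artinian monomial ideals for which the largest degree of any pure power in $G(I)$ equals $n$. For $I\in\mathcal{A}_d(n)$, $\varphi(I)=\{\alpha\in\mathbb{N}^d\mid \mathbf{x}^\alpha\notin I\}$. A monomial ideal $I$ is strongly stable if $m\frac{x_i}{x_j}\in I$ for all monomials $m\in I$ and all $i<j$ with $x_j\mid m$. A $d$-dimensional partition is a finite subset $P\subset\mathbb{N}^d$ such that $(a_1,\dots,a_j,\dots,a_d)\in P$ implies $(a_1,\dots,a_j-1,\dots,a_d)\in P$ for all $j$ with $a_j>0$; its elements are called cells. For a cell $\alpha\in P$, the $j$th arm length $h_j$ is the largest integer such that $(a_1,\dots,a_j+h_j,\dots,a_d)\in P$, and $H(\alpha)=(h_1,\dots,h_d)$ is its Hook vector. A strongly stable partition is a partition for which every cell's Hook vector is weakly increasing ($h_1\le\cdots\le h_d$). -}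

module Defs where

open import Algebra.Apartness.Bundles using (HeytingCommutativeRing; HeytingField)
open import Algebra.Bundles using (CommutativeRing)
open import Data.Bool.Base using (if_then_else_)
open import Data.Fin.Base as Fin using (Fin)
open import Data.List.Base using (List; []; _∷_; _++_; map)
open import Data.List.Membership.Propositional using () renaming (_∈_ to _∈ˡ_)
open import Data.Nat.Base using (ℕ; suc; pred; _+_; _≤_; _<_)
import Data.Nat.Properties as ℕ
open import Data.Product.Base using (∃-syntax; _×_; _,_)
open import Data.Vec.Base using (Vec; lookup; replicate; zipWith; _[_]%=_; _[_]≔_)
open import Data.Vec.Properties using (≡-dec)
open import Level using (Level; _⊔_) renaming (suc to lsuc)
open import Relation.Binary.PropositionalEquality using (_≡_)
open import Relation.Nullary.Decidable.Core using (does)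
open import Relation.Nullary.Negation.Core using (¬_)
open import Relation.Unary using (Pred; _∈_; _⊆_; _≐_)

-- A point of ℕᵈ, serving both as the exponent vector α of a monomial xᵅ and
-- as a potential cell of a partition.
Exponent : ℕ → Set
Exponent d = Vec ℕ d

-- The exponent vector of x_jᵏ.
purePower : ∀ {d} → Fin d → ℕ → Exponent d
purePower j k = replicate _ 0 [ j ]≔ k

------------------------------------------------------------------------
-- Partitions

module _ {d : ℕ} {p : Level} (P : Pred (Exponent d) p) where

  IsFinite : Set p
  IsFinite = ∃[ L ] P ≐ (_∈ˡ L)

  record IsPartition : Set p where
    field
      finite     : IsFinite
      downClosed : ∀ α j → α ∈ P → 0 < lookup α j → (α [ j ]%= pred) ∈ P

  record IsArmLength (α : Exponent d) (j : Fin d) (h : ℕ) : Set p where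
    field
      attained : (α [ j ]%= (_+ h)) ∈ P
      largest  : ∀ k → (α [ j ]%= (_+ k)) ∈ P → k ≤ h

  -- Relational: H is the Hook vector H(α), which is unique when it exists and
  -- exists for every cell of a finite P.
  IsHookVector : Exponent d → Vec ℕ d → Set p
  IsHookVector α H = ∀ j → IsArmLength α j (lookup H j)

  WeaklyIncreasing : Vec ℕ d → Set
  WeaklyIncreasing H = ∀ i j → i Fin.≤ j → lookup H i ≤ lookup H j

  record IsStronglyStablePartition : Set p where
    field
      isPartition : IsPartition
      hooks       : ∀ α → α ∈ P → ∃[ H ] IsHookVector α H × WeaklyIncreasing H

------------------------------------------------------------------------
-- Polynomials

-- Fields are Heyting fields.  Classically these are exactly the fields, with
-- x # y the negation of x ≈ y.

module _ {c ℓ₁ ℓ₂ : Level} (K : HeytingField c ℓ₁ ℓ₂) where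
  open HeytingField K using (heytingCommutativeRing; 0#; 1#; _≈_)
  open HeytingCommutativeRing heytingCommutativeRing using (commutativeRing)
  open CommutativeRing commutativeRing using (+-rawMonoid)
  open import Algebra.Definitions.RawMonoid +-rawMonoid using () renaming (_×_ to _·_)

  CharacteristicZero : Set ℓ₁
  CharacteristicZero = ∀ m → m · 1# ≈ 0# → m ≡ 0

module Polynomials {c ℓ₁ ℓ₂ : Level} (K : HeytingField c ℓ₁ ℓ₂) (d : ℕ) where
  private module K = HeytingField K

  -- K[x₁,…,x_d]: formal sums of terms a xᵅ, in which exponents may repeat and
  -- coefficients may vanish; the equality _≈ₚ_ compares the total coefficient
  -- of every monomial.
  Poly : Set c
  Poly = List (K.Carrier × Exponent d)

  coeff : Poly → Exponent d → K.Carrier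
  coeff []            α = K.0#
  coeff ((a , β) ∷ p) α =
    (if does (≡-dec ℕ._≟_ β α) then a else K.0#) K.+ coeff p α

  infix 4 _≈ₚ_
  _≈ₚ_ : Poly → Poly → Set ℓ₁
  p ≈ₚ q = ∀ α → coeff p α K.≈ coeff q α

  0ₚ : Poly
  0ₚ = []

  infixl 6 _+ₚ_
  _+ₚ_ : Poly → Poly → Poly
  p +ₚ q = p ++ q

  infixl 7 _*ₚ_
  _*ₚ_ : Poly → Poly → Poly
  []            *ₚ q = []
  ((a , α) ∷ p) *ₚ q =
    map (λ { (b , β) → a K.* b , zipWith _+_ α β }) q +ₚ p *ₚ q

  x^_ : Exponent d → Poly
  x^ α = (K.1# , α) ∷ []

  ----------------------------------------------------------------------
  -- Monomial ideals

  -- Closure under negation follows from closure under multiplication by -1.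
  record IsIdeal {i : Level} (I : Pred Poly i) : Set (c ⊔ ℓ₁ ⊔ i) where
    field
      resp     : ∀ {p q} → p ≈ₚ q → p ∈ I → q ∈ I
      0-closed : 0ₚ ∈ I
      +-closed : ∀ {p q} → p ∈ I → q ∈ I → p +ₚ q ∈ I
      *-closed : ∀ f {p} → p ∈ I → f *ₚ p ∈ I

  -- The least ideal containing xᵅ for every α ∈ S.
  data ⟨_⟩ {s : Level} (S : Pred (Exponent d) s) : Pred Poly (c ⊔ ℓ₁ ⊔ s) where
    gen      : ∀ {α} → α ∈ S → x^ α ∈ ⟨ S ⟩
    resp     : ∀ {p q} → p ≈ₚ q → p ∈ ⟨ S ⟩ → q ∈ ⟨ S ⟩
    0-closed : 0ₚ ∈ ⟨ S ⟩
    +-closed : ∀ {p q} → p ∈ ⟨ S ⟩ → q ∈ ⟨ S ⟩ → p +ₚ q ∈ ⟨ S ⟩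
    *-closed : ∀ f {p} → p ∈ ⟨ S ⟩ → f *ₚ p ∈ ⟨ S ⟩

  -- S lives at the level of I without loss of generality: a monomial ideal is
  -- generated by the set of all monomials it contains.
  record IsMonomialIdeal {i : Level} (I : Pred Poly i) : Set (c ⊔ ℓ₁ ⊔ lsuc i) where
    field
      isIdeal   : IsIdeal I
      S         : Pred (Exponent d) i
      generated : I ≐ ⟨ S ⟩

  -- The finite set of (exponents of) monomials listed by G is G(I).
  record IsMinimalGenerators {i : Level} (I : Pred Poly i) (G : List (Exponent d))
         : Set (c ⊔ ℓ₁ ⊔ i) where
    field
      generates : I ≐ ⟨ _∈ˡ G ⟩
      minimal   : ∀ G′ → (_∈ˡ G′) ⊆ (_∈ˡ G) → I ≐ ⟨ _∈ˡ G′ ⟩ → (_∈ˡ G) ⊆ (_∈ˡ G′)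

  IsArtinian : {i : Level} → Pred Poly i → Set i
  IsArtinian I = ∀ j → ∃[ k ] x^ purePower j k ∈ I

  record Is𝒜 {i : Level} (n : ℕ) (I : Pred Poly i) : Set (c ⊔ ℓ₁ ⊔ lsuc i) where
    field
      isMonomialIdeal     : IsMonomialIdeal I
      isArtinian          : IsArtinian I
      -- Classically such a G always exists (Dickson's lemma).
      G                   : List (Exponent d)
      isMinimalGenerators : IsMinimalGenerators I G
      attained            : ∃[ j ] purePower j n ∈ˡ G
      largest             : ∀ j k → purePower j k ∈ˡ G → k ≤ n

  -- α [ j ]%= pred [ i ]%= suc is the exponent of m x_i / x_j for m = xᵅ.
  IsStronglyStable : {i : Level} → Pred Poly i → Set i
  IsStronglyStable I = ∀ α i j → i Fin.< j → 0 < lookup α j →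
    x^ α ∈ I → x^ (α [ j ]%= pred [ i ]%= suc) ∈ I

  φ : {i : Level} → Pred Poly i → Pred (Exponent d) i
  φ I α = ¬ (x^ α ∈ I)

{-# OPTIONS --safe #-}
-- Whether xᵅ lies in I is decided by the finite set G(I), because every
-- element of ⟨G⟩ has zero coefficient at each monomial that no element of G
-- divides.  The rest is combinatorics of the up-set U = {α ∣ xᵅ ∈ I}.
--   If I is strongly stable, trading h copies of x_j for h copies of x_i shows
-- that α + h e_j ∈ U implies α + h e_i ∈ U, hence h_i ≤ h_j.
--   Conversely, suppose α ∈ U but β + e_i ∉ U, where β = α − e_j.  In the
-- partition, the i-th arm of β has length at least 1, so its j-th arm does too,
-- which puts β + e_j = α outside U.
module Submission where

open import Defs
open import Algebra.Apartness.Bundles using (HeytingField)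
open import Data.Bool.Base using (true; false)
open import Data.Fin.Base as Fin using (Fin; zero; suc)
import Data.Fin.Properties as Fin
open import Data.List.Base using (List; []; _∷_; [_]; _++_; cartesianProductWith; filter; upTo)
open import Data.List.Membership.Propositional using (find; lose) renaming (_∈_ to _∈ˡ_)
open import Data.List.Membership.Propositional.Properties
  using (∈-cartesianProductWith⁺; ∈-filter⁺; ∈-filter⁻; ∈-upTo⁺)
open import Data.List.Properties using (++-identityʳ)
open import Data.List.Relation.Unary.Any using (Any; any?; here)
open import Data.Nat.Base using (ℕ; NonZero; zero; suc; pred; _+_; _∸_; _≤_; _<_; z≤n; s≤s)
open import Data.Nat.Properties
  using (≤-refl; ≤-reflexive; ≤-trans; ≤-pred; <-irrefl; ≤∧≢⇒<; ≮⇒≥; <⇒≤; n≤1+n; pred[n]≤n;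
         _≤?_; _≟_; m≤m+n; m≤n+m; m+[n∸m]≡n; +-comm; +-suc; +-identityʳ; +-cancelˡ-≡)
open import Data.Product.Base using (∃-syntax; _×_; _,_; proj₁; proj₂)
open import Data.Vec.Base using (Vec; []; _∷_; lookup; tabulate; replicate; zipWith; _[_]%=_)
open import Data.Vec.Properties
  using (≡-dec; ∷-injective; lookup∘tabulate; lookup∘updateAt; updateAt-id; updateAt-id-local;
         updateAt-cong; updateAt-updateAt; updateAt-commutes; zipWith-comm)
open import Data.Vec.Relation.Binary.Pointwise.Inductive as Pointwise using (Pointwise; []; _∷_)
open import Function.Base using (id; _∘_)
open import Function.Bundles using (_⇔_; mk⇔)
open import Level using (Level)
open import Relation.Binary.Definitions using (Decidable)
open import Relation.Binary.PropositionalEquality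
  using (_≡_; _≢_; refl; sym; trans; cong; cong₂; subst; subst₂)
open import Relation.Nullary.Decidable
  using (yes; no; does; ¬?; map′; dec-true; dec-false; decidable-stable)
open import Relation.Nullary.Negation using (¬_)
open import Relation.Unary using (Pred; _∈_) renaming (Decidable to Decidable₁)

private
  variable
    d : ℕ

-- Divisibility of monomials as the componentwise order on exponents.

infix 4 _≼_
_≼_ : Exponent d → Exponent d → Set
_≼_ = Pointwise _≤_

_≼?_ : Decidable (_≼_ {d})
_≼?_ = Pointwise.decidable _≤?_

≼-refl : {α : Exponent d} → α ≼ α
≼-refl = Pointwise.refl ≤-refl

≼-trans : {α β γ : Exponent d} → α ≼ β → β ≼ γ → α ≼ γ
≼-trans = Pointwise.trans ≤-trans

≼-+ : (δ ε : Exponent d) → δ ≼ zipWith _+_ δ ε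
≼-+ []      []      = []
≼-+ (x ∷ δ) (y ∷ ε) = m≤m+n x y ∷ ≼-+ δ ε

-- Truncated subtraction is exact in every coordinate below `α`, so `zipWith _∸_ α δ` is the
-- exponent of the quotient monomial.
+-∸-≼ : {δ α : Exponent d} → δ ≼ α → zipWith _+_ δ (zipWith _∸_ α δ) ≡ α
+-∸-≼ []        = refl
+-∸-≼ (p ∷ δ≼α) = cong₂ _∷_ (m+[n∸m]≡n p) (+-∸-≼ δ≼α)

zipWith-+-cancelˡ : (δ : Exponent d) {β ε : Exponent d} →
                    zipWith _+_ δ β ≡ zipWith _+_ δ ε → β ≡ ε
zipWith-+-cancelˡ []      {[]}    {[]}    _  = refl
zipWith-+-cancelˡ (x ∷ δ) {_ ∷ _} {_ ∷ _} eq with ∷-injective eq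
... | p , q = cong₂ _∷_ (+-cancelˡ-≡ x _ _ p) (zipWith-+-cancelˡ δ q)

[]%=-mono-≼ : {α β : Exponent d} (j : Fin d) {f g : ℕ → ℕ} → α ≼ β →
              f (lookup α j) ≤ g (lookup β j) → α [ j ]%= f ≼ β [ j ]%= g
[]%=-mono-≼ zero    (_ ∷ α≼β) q = q ∷ α≼β
[]%=-mono-≼ (suc j) (p ∷ α≼β) q = p ∷ []%=-mono-≼ j α≼β q

≼-[]%= : {α : Exponent d} (j : Fin d) {f : ℕ → ℕ} →
         lookup α j ≤ f (lookup α j) → α ≼ α [ j ]%= f
≼-[]%= {α = α} j {f} p =
  subst (_≼ α [ j ]%= f) (updateAt-id j α) ([]%=-mono-≼ {α = α} {α} j {id} {f} ≼-refl p)

[]%=-≼ : {α : Exponent d} (j : Fin d) {f : ℕ → ℕ} →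
         f (lookup α j) ≤ lookup α j → α [ j ]%= f ≼ α
[]%=-≼ {α = α} j {f} p =
  subst (α [ j ]%= f ≼_) (updateAt-id j α) ([]%=-mono-≼ {α = α} {α} j {f} {id} ≼-refl p)

0-≼ : (α : Exponent d) → replicate d 0 ≼ α
0-≼ []      = []
0-≼ (_ ∷ α) = z≤n ∷ 0-≼ α

purePower-≼ : {α : Exponent d} (j : Fin d) {k : ℕ} → k ≤ lookup α j → purePower j k ≼ α
purePower-≼ {α = α} j p = subst (_ ≼_) (updateAt-id j α) ([]%=-mono-≼ j (0-≼ α) p)

-- Finite boxes and bounded search.

box : Vec ℕ d → List (Exponent d)
box []       = [ [] ]
box (k ∷ ks) = cartesianProductWith _∷_ (upTo k) (box ks)

∈-box : (ks α : Exponent d) → (∀ j → lookup α j < lookup ks j) → α ∈ˡ box ks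
∈-box []       []      _ = here refl
∈-box (k ∷ ks) (x ∷ α) p =
  ∈-cartesianProductWith⁺ _∷_ (∈-upTo⁺ (p zero)) (∈-box ks α (p ∘ suc))

-- The search runs downward: where `Q` fails at the bound, the bound drops by one, and `Q 0` answers
-- if it reaches 0.
greatest : ∀ {q} {Q : Pred ℕ q} → Decidable₁ Q → Q 0 → ∀ b → (∀ k → Q k → k ≤ b) →
           ∃[ h ] Q h × (∀ k → Q k → k ≤ h)
greatest Q? q₀ zero    bound = 0 , q₀ , bound
greatest Q? q₀ (suc b) bound with Q? (suc b)
... | yes q = suc b , q , bound
... | no ¬q = greatest Q? q₀ b λ k qk →
  ≤-pred (≤∧≢⇒< (bound k qk) λ { refl → ¬q qk })

-- Trading copies of one variable for another.

Shiftable : ∀ {u} → Pred (Exponent d) u → Set u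
Shiftable U = ∀ α i j → i Fin.< j → 0 < lookup α j → U α → U (α [ j ]%= pred [ i ]%= suc)

lookup-+-suc : (α : Exponent d) (j : Fin d) (k : ℕ) → 0 < lookup (α [ j ]%= (_+ suc k)) j
lookup-+-suc (x ∷ α) zero    k = ≤-trans (s≤s z≤n) (≤-reflexive (sym (+-suc x k)))
lookup-+-suc (x ∷ α) (suc j) k = lookup-+-suc α j k

-- Induction on `k`, one unit at a time: α + (k+1)e_j becomes (α + e_i) + k e_j, and the induction
-- hypothesis applies to α + e_i.
shift : ∀ {u} {U : Pred (Exponent d) u} → Shiftable U → ∀ {i j} → i Fin.< j →
        ∀ k α → U (α [ j ]%= (_+ k)) → U (α [ i ]%= (_+ k))
shift {U = U} shiftable {i} {j} i<j zero α =
  subst U (trans (updateAt-id-local j α (+-identityʳ _))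
                 (sym (updateAt-id-local i α (+-identityʳ _))))
shift {U = U} shiftable {i} {j} i<j (suc k) α u =
  subst U
    (trans (updateAt-updateAt i α)
           (updateAt-cong i (λ x → sym (+-suc x k)) α))
    (shift shiftable i<j k (α [ i ]%= suc)
      (subst U step (shiftable _ i j i<j (lookup-+-suc α j k) u)))
  where
  step : α [ j ]%= (_+ suc k) [ j ]%= pred [ i ]%= suc ≡ α [ i ]%= suc [ j ]%= (_+ k)
  step = trans
    (cong (_[ i ]%= suc)
      (trans (updateAt-updateAt j α)
             (updateAt-cong j (λ x → cong pred (+-suc x k)) α)))
    (updateAt-commutes i j (λ { refl → <-irrefl refl i<j }) α)

module _ {u} {U : Pred (Exponent d) u} (U? : Decidable₁ U)
         (up : ∀ {α β} → α ≼ β → U α → U β)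
         (pure : ∀ j → ∃[ k ] U (purePower j k)) where

  private
    P : Pred (Exponent d) u
    P α = ¬ U α

    bound : Vec ℕ d
    bound = tabulate (proj₁ ∘ pure)

  P-bounded : ∀ {α} → P α → ∀ j → lookup α j < proj₁ (pure j)
  P-bounded {α} ¬Uα j = decidable-stable (_ ≤? _) λ α≮k →
    ¬Uα (up (purePower-≼ j (≮⇒≥ α≮k)) (proj₂ (pure j)))

  complement-isPartition : IsPartition P
  complement-isPartition = record
    -- Pure powers in `U` confine the complement to a box, which is then filtered by the decision
    -- procedure.
    { finite     = filter (¬? ∘ U?) (box bound)
                 , (λ {α} ¬Uα → ∈-filter⁺ (¬? ∘ U?) (∈-box bound α λ j →
                     subst (lookup α j <_) (sym (lookup∘tabulate _ j)) (P-bounded ¬Uα j)) ¬Uα)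
                 , (λ α∈ → proj₂ (∈-filter⁻ (¬? ∘ U?) {xs = box bound} α∈))
    ; downClosed = λ α j ¬Uα _ → ¬Uα ∘ up ([]%=-≼ j pred[n]≤n)
    }

  armLength : ∀ {α} → P α → ∀ j → ∃[ h ] IsArmLength P α j h
  armLength {α} ¬Uα j
    with greatest (λ k → ¬? (U? (α [ j ]%= (_+ k))))
                  (subst P (sym (updateAt-id-local j α (+-identityʳ _))) ¬Uα)
                  (proj₁ (pure j))
                  -- An arm cannot outgrow the pure power: k ≤ α_j + k, and the latter stays below
                  -- its exponent.
                  (λ k ¬U → ≤-trans (m≤n+m k (lookup α j)) (<⇒≤
                    (subst (_< _) (lookup∘updateAt j α) (P-bounded ¬U j))))
  ... | h , attained , largest = h , record { attained = attained ; largest = largest }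

  shiftable⇒stronglyStable : Shiftable U → IsStronglyStablePartition P
  shiftable⇒stronglyStable shiftable = record
    { isPartition = complement-isPartition
    ; hooks       = λ α ¬Uα → tabulate (arm ¬Uα)
                            , (λ j → subst (IsArmLength P α j) (sym (lookup∘tabulate _ j))
                                           (proj₂ (armLength ¬Uα j)))
                            , λ i j i≤j → subst₂ _≤_ (sym (lookup∘tabulate _ i))
                                                     (sym (lookup∘tabulate _ j))
                                                     (arm-mono ¬Uα i j i≤j)
    }
    where
    arm : ∀ {α} → P α → Fin d → ℕ
    arm ¬Uα j = proj₁ (armLength ¬Uα j)

    arm-mono : ∀ {α} (¬Uα : P α) i j → i Fin.≤ j → arm ¬Uα i ≤ arm ¬Uα j
    arm-mono {α} ¬Uα i j i≤j with i Fin.≟ j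
    ... | yes refl = ≤-refl
    -- Maximality of h_j is applied to h_i: were α + h_i e_j in `U`, shifting would put the cell α +
    -- h_i e_i there.
    ... | no i≢j   = largest (proj₂ (armLength ¬Uα j)) _
      (attained (proj₂ (armLength ¬Uα i)) ∘ shift shiftable (Fin.≤∧≢⇒< i≤j i≢j) _ α)
      where open IsArmLength

  stronglyStable⇒shiftable : IsStronglyStablePartition P → Shiftable U
  stronglyStable⇒shiftable stable α i j i<j _ Uα =
    decidable-stable (U? _) λ ¬Uβ+eᵢ →
      let H , isHook , increasing = IsStronglyStablePartition.hooks stable β
            (¬Uβ+eᵢ ∘ up (≼-[]%= i (n≤1+n _)))
          1≤hᵢ = IsArmLength.largest (isHook i) 1
            (¬Uβ+eᵢ ∘ subst U (updateAt-cong i (λ x → +-comm x 1) β))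
          1≤hⱼ = ≤-trans 1≤hᵢ (increasing i j (<⇒≤ i<j))
      -- The known cell is β + h_j e_j; since h_j ≥ 1 it lies above `α`, so `Uα` would put it in
      -- `U`.
      in IsArmLength.attained (isHook j) (up (α≼β+heⱼ 1≤hⱼ) Uα)
    where
    β = α [ j ]%= pred

    -- `pred` removes at most one and `h` restores at least one.
    n≤pred[n]+h : ∀ n {h} → 1 ≤ h → n ≤ pred n + h
    n≤pred[n]+h zero            _ = z≤n
    n≤pred[n]+h (suc n) {suc h} _ = subst (suc n ≤_) (sym (+-suc n h)) (s≤s (m≤m+n n h))

    α≼β+heⱼ : ∀ {h} → 1 ≤ h → α ≼ β [ j ]%= (_+ h)
    α≼β+heⱼ 1≤h = subst (α ≼_) (sym (updateAt-updateAt j α))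
      (≼-[]%= j (n≤pred[n]+h (lookup α j) 1≤h))

-- Coefficients and membership of monomials in a monomial ideal.

module _ {c ℓ₁ ℓ₂} (K : HeytingField c ℓ₁ ℓ₂) (d : ℕ) where
  open Polynomials K d
  private module K = HeytingField K

  coeff-++ : ∀ p q α → coeff (p ++ q) α K.≈ coeff p α K.+ coeff q α
  coeff-++ []            q α = K.sym (K.+-identityˡ _)
  coeff-++ ((a , β) ∷ p) q α =
    K.trans (K.+-congˡ (coeff-++ p q α)) (K.sym (K.+-assoc _ _ _))

  coeff-∷-≡ : ∀ a β p → coeff ((a , β) ∷ p) β K.≈ a K.+ coeff p β
  coeff-∷-≡ a β p rewrite dec-true (≡-dec _≟_ β β) refl = K.refl

  coeff-∷-≢ : ∀ a β {α} p → β ≢ α → coeff ((a , β) ∷ p) α K.≈ coeff p α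
  coeff-∷-≢ a β {α} p β≢α rewrite dec-false (≡-dec _≟_ β α) β≢α = K.+-identityˡ _

  -- Adding `δ` is injective on exponents, so a term of `q` contributes at δ + ε exactly when its
  -- own exponent is `ε`.
  coeff-term-* : ∀ a δ q ε →
    coeff ([ (a , δ) ] *ₚ q) (zipWith _+_ δ ε) K.≈ a K.* coeff q ε
  coeff-term-* a δ []            ε = K.sym (K.zeroʳ a)
  coeff-term-* a δ ((b , β) ∷ q) ε with ≡-dec _≟_ β ε
  ... | yes refl = K.trans
    (coeff-∷-≡ (a K.* b) (zipWith _+_ δ β) ([ (a , δ) ] *ₚ q))
    (K.trans (K.+-congˡ (coeff-term-* a δ q ε)) (K.sym (K.distribˡ a b _)))
  ... | no β≢ε   = K.trans
    (coeff-∷-≢ (a K.* b) (zipWith _+_ δ β) ([ (a , δ) ] *ₚ q) (β≢ε ∘ zipWith-+-cancelˡ δ))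
    (K.trans (coeff-term-* a δ q ε) (K.*-congˡ (K.sym (K.+-identityˡ _))))

  coeff-term-*-∤ : ∀ a δ q {α} → ¬ δ ≼ α → coeff ([ (a , δ) ] *ₚ q) α K.≈ K.0#
  coeff-term-*-∤ a δ []            δ⋠α = K.refl
  coeff-term-*-∤ a δ ((b , β) ∷ q) δ⋠α = K.trans
    (coeff-∷-≢ (a K.* b) (zipWith _+_ δ β) ([ (a , δ) ] *ₚ q) λ { refl → δ⋠α (≼-+ δ β) })
    (coeff-term-*-∤ a δ q δ⋠α)

  -- Splits off one term so that the single-term lemmas apply; the one-term product ends in an extra
  -- `[]`.
  *ₚ-∷ : ∀ t f p → (t ∷ f) *ₚ p ≡ ([ t ] *ₚ p) ++ f *ₚ p
  *ₚ-∷ (a , α) f p = cong (_++ f *ₚ p) (sym (++-identityʳ _))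

  module _ {s} {S : Pred (Exponent d) s} where

    Avoids : Pred (Exponent d) s
    Avoids α = ∀ {γ} → γ ∈ S → ¬ γ ≼ α

    -- A term at `δ` contributes at `α` only if δ ≼ α, and then through the coefficient of `p` at α
    -- - δ. This exponent divides `α`, so it is avoided as well.
    coeff-*-vanishes : ∀ f p → (∀ {α} → Avoids α → coeff p α K.≈ K.0#) →
                       ∀ {α} → Avoids α → coeff (f *ₚ p) α K.≈ K.0#
    coeff-*-vanishes []            p vanishes avoids = K.refl
    coeff-*-vanishes ((a , δ) ∷ f) p vanishes {α} avoids
      rewrite *ₚ-∷ (a , δ) f p = K.trans
        (coeff-++ ([ (a , δ) ] *ₚ p) (f *ₚ p) α)
        (K.trans (K.+-cong term (coeff-*-vanishes f p vanishes avoids)) (K.+-identityˡ _))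
      where
      term : coeff ([ (a , δ) ] *ₚ p) α K.≈ K.0#
      term with δ ≼? α
      ... | no δ⋠α  = coeff-term-*-∤ a δ p δ⋠α
      ... | yes δ≼α = K.trans
        (subst (λ β → coeff ([ (a , δ) ] *ₚ p) β K.≈ a K.* coeff p ε)
               (+-∸-≼ δ≼α) (coeff-term-* a δ p ε))
        (K.trans (K.*-congˡ (vanishes λ γ∈S γ≼ε → avoids γ∈S (≼-trans γ≼ε ε≼α))) (K.zeroʳ a))
        where
        ε = zipWith _∸_ α δ
        ε≼α : ε ≼ α
        ε≼α = subst (ε ≼_) (trans (zipWith-comm +-comm ε δ) (+-∸-≼ δ≼α)) (≼-+ ε δ)

    -- Induction on the derivation of membership: every ideal operation preserves vanishing at
    -- avoided exponents, and a generator cannot avoid itself.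
    coeff-vanishes : ∀ {p} → p ∈ ⟨ S ⟩ → ∀ {α} → Avoids α → coeff p α K.≈ K.0#
    coeff-vanishes (gen {γ} γ∈S) avoids =
      coeff-∷-≢ K.1# γ [] λ { refl → avoids γ∈S ≼-refl }
    coeff-vanishes (resp p≈q p∈) {α} avoids =
      K.trans (K.sym (p≈q α)) (coeff-vanishes p∈ avoids)
    coeff-vanishes 0-closed avoids = K.refl
    coeff-vanishes (+-closed {p} {q} p∈ q∈) {α} avoids = K.trans (coeff-++ p q α)
      (K.trans (K.+-cong (coeff-vanishes p∈ avoids) (coeff-vanishes q∈ avoids))
               (K.+-identityˡ _))
    coeff-vanishes (*-closed f {p} p∈) avoids =
      coeff-*-vanishes f p (coeff-vanishes p∈) avoids

  x^-mono-≼ : ∀ {i} {I : Pred Poly i} → IsIdeal I → ∀ {α β} → α ≼ β → x^ α ∈ I → x^ β ∈ I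
  x^-mono-≼ {I = I} isIdeal {α} {β} α≼β xα∈I =
    IsIdeal.resp isIdeal x^δ*x^α≈x^β (IsIdeal.*-closed isIdeal (x^ δ) xα∈I)
    where
    δ = zipWith _∸_ β α

    x^δ*x^α≈x^β : x^ δ *ₚ x^ α ≈ₚ x^ β
    x^δ*x^α≈x^β γ
      -- Once the exponent (β - α) + α is rewritten to `β`, both sides are single terms there, with
      -- coefficients 1 · 1 and 1.
      rewrite trans (zipWith-comm +-comm δ α) (+-∸-≼ α≼β) with does (≡-dec _≟_ β γ)
    ... | true  = K.+-congʳ (K.*-identityˡ _)
    ... | false = K.refl

  x^-∈? : ∀ {i n} {I : Pred Poly i} → CharacteristicZero K → Is𝒜 n I →
          Decidable₁ (λ α → x^ α ∈ I)
  x^-∈? {I = I} char0 I∈𝒜 α = map′ divisible⇒∈ ∈⇒divisible (any? (_≼? α) G)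
    where
    open Is𝒜 I∈𝒜
    open IsMinimalGenerators isMinimalGenerators

    divisible⇒∈ : Any (_≼ α) G → x^ α ∈ I
    divisible⇒∈ divisible with find divisible
    ... | γ , γ∈G , γ≼α =
      x^-mono-≼ (IsMonomialIdeal.isIdeal isMonomialIdeal) γ≼α (proj₂ generates (gen γ∈G))

    1≉0 : ¬ K.1# K.≈ K.0#
    -- The multiple 1 · 1# unfolds to 1# + 0#, so characteristic zero at m = 1 would give 1 ≡ 0.
    1≉0 1≈0 with char0 1 (K.trans (K.+-identityʳ _) 1≈0)
    ... | ()

    ∈⇒divisible : x^ α ∈ I → Any (_≼ α) G
    -- If no element of `G` divides xᵅ, its own coefficient 1 at `α` must vanish.
    ∈⇒divisible xα∈I = decidable-stable (any? (_≼? α) G) λ ¬divisible →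
      1≉0 (K.trans (K.sym (K.trans (coeff-∷-≡ K.1# α []) (K.+-identityʳ _)))
        (coeff-vanishes (proj₁ generates xα∈I) λ γ∈G γ≼α → ¬divisible (lose γ∈G γ≼α)))

proposition4p5 :
    {c ℓ₁ ℓ₂ i : Level} (d n : ℕ) .{{_ : NonZero d}} .{{_ : NonZero n}}
    (K : HeytingField c ℓ₁ ℓ₂) → CharacteristicZero K →
    (I : Pred (Polynomials.Poly K d) i) → Polynomials.Is𝒜 K d n I →
    Polynomials.IsStronglyStable K d I ⇔ IsStronglyStablePartition (Polynomials.φ K d I)
proposition4p5 d n K char0 I I∈𝒜 =
  -- For U = {α ∣ xᵅ ∈ I}, `Shiftable` unfolds to strong stability of `I`, and the complement of U
  -- is `φ` of `I` by definition.
  mk⇔ (shiftable⇒stronglyStable ∈? up isArtinian) (stronglyStable⇒shiftable ∈? up isArtinian)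
  where
  open Polynomials K d
  open Is𝒜 I∈𝒜

  ∈? : Decidable₁ (λ α → x^ α ∈ I)
  ∈? = x^-∈? K d char0 I∈𝒜

  up : ∀ {α β} → α ≼ β → x^ α ∈ I → x^ β ∈ I
  up = x^-mono-≼ K d (IsMonomialIdeal.isIdeal isMonomialIdeal)
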